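{- There exists a peak-pit Condorcet domain on a set of $11$ alternatives that consists of exactly $2349$ linear orders.
   Context: Let $X_n=\{1,\dots,n\}$ be the set of alternatives and let $L(X_n)$ be the set of all linear orders (permutations, written from most to least preferred) on $X_n$. A domain is a subset $D\subseteq L(X_n)$; its size is $|D|$. A domain $D$ is a Condorcet domain if for every preference profile with an odd number of agents, each of whose preference orders belongs to $D$, the majority relation of the profile is transitive. Equivalently (Sen), for every triple $x<y<z$ in $X_n$ the restriction of $D$ to $\{x,y,z\}$ satisfies a never condition $iNj$ for some $i,j\in\{1,2,3\}$, where $iNj$ means: in the restriction to $\{x,y,z\}$ of every order of $D$, the $i$-th alternative of the triple (first $=x$, second $=y$, third $=z$) is never in the $j$-th position (first position = most preferred). A Condorcet domain is peak-pit if for every triple the restriction of the domain to the triple satisfies a never condition of the form $iN3$ or of the form $iN1$ for some $i\in\{1,2,3\}$. -}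

module Defs where

open import Data.Fin.Base using (Fin; _<_)
open import Data.Fin.Properties using (_<?_)
open import Data.Fin.Permutation using (Permutation′; _⟨$⟩ˡ_; _≈_)
open import Data.List.Base using (List; length)
import Data.List.Membership.Setoid as Membership
import Data.List.Relation.Unary.Unique.Setoid as UniqueSetoid
open import Data.Nat.Base as ℕ using (ℕ; suc; _*_)
open import Data.Product.Base using (∃-syntax; _×_)
open import Data.Sum.Base using (_⊎_)
open import Data.Vec.Base using (Vec; []; _∷_; count; lookup)
open import Data.Vec.Relation.Unary.All using (All)
open import Function.Bundles using (_⇔_)
open import Level using (0ℓ)
open import Relation.Binary.Bundles using (Setoid)
open import Relation.Binary.Core using (Rel)
open import Relation.Binary.Definitions using (Transitive; Decidable)
open import Relation.Binary.PropositionalEquality using (_≡_; _≢_; refl; sym; trans)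
open import Relation.Unary using (Pred; _∈_)

private
  variable
    n m : ℕ

-- A linear order π is a bijection from positions to alternatives:
-- π ⟨$⟩ʳ p is the alternative in position p, and position zero is the most
-- preferred one.  So π ⟨$⟩ˡ x is the position of the alternative x.
LinearOrder : ℕ → Set
LinearOrder n = Permutation′ n

-- Bijections are compared pointwise, since _≡_ on them also compares proofs.
linearOrders : ℕ → Setoid 0ℓ 0ℓ
linearOrders n = record
  { Carrier       = LinearOrder n
  ; _≈_           = _≈_
  ; isEquivalence = record
    { refl  = λ _ → refl
    ; sym   = λ p i → sym (p i)
    ; trans = λ p q i → trans (p i) (q i)
    }
  }

Prefers : LinearOrder n → Rel (Fin n) 0ℓ
Prefers π x y = π ⟨$⟩ˡ x < π ⟨$⟩ˡ y

prefers? : (π : LinearOrder n) → Decidable (Prefers π)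
prefers? π x y = (π ⟨$⟩ˡ x) <? (π ⟨$⟩ˡ y)

Domain : ℕ → Set₁
Domain n = Pred (LinearOrder n) 0ℓ

-- The equivalence also forces D to be closed under _≈_.
HasSize : Domain n → ℕ → Set
HasSize {n} D k =
  ∃[ πs ] Unique πs × length πs ≡ k × (∀ π → π ∈ D ⇔ π ∈ₗ πs)
  where
  open UniqueSetoid (linearOrders n) using (Unique)
  open Membership (linearOrders n) using () renaming (_∈_ to _∈ₗ_)

Profile : ℕ → ℕ → Set
Profile n m = Vec (LinearOrder n) m

support : Profile n m → Fin n → Fin n → ℕ
support P x y = count (λ π → prefers? π x y) P

Majority : Profile n m → Rel (Fin n) 0ℓ
Majority P x y = support P y x ℕ.< support P x y

IsCondorcet : Domain n → Set
IsCondorcet {n} D =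
  ∀ k (P : Profile n (suc (2 * k))) → All (_∈ D) P → Transitive (Majority P)

-- The position, counted from 1, of x in the restriction of π to the
-- alternatives in t (of which x is one).
position : LinearOrder n → Vec (Fin n) m → Fin n → ℕ
position π t x = suc (count (λ y → prefers? π y x) t)

-- The never condition iNj on the triple t.  The index i is an element of
-- Fin 3, hence counted from 0, whereas j is counted from 1.
Never : Domain n → Vec (Fin n) 3 → Fin 3 → ℕ → Set
Never D t i j = ∀ π → π ∈ D → position π t (lookup t i) ≢ j

IsPeakPit : Domain n → Set
IsPeakPit {n} D =
  ∀ (x y z : Fin n) → x < y → y < z →
  let t = x ∷ y ∷ z ∷ [] in
  (∃[ i ] Never D t i 3) ⊎ (∃[ i ] Never D t i 1)

{-# OPTIONS --safe #-}

-- A tail of a linear order is the set of alternatives from some position down.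
-- If some order of a domain ranks x last (first) among x, y, z, then one of its
-- tails meets {x, y, z} in {x} (in {y, z}).  Hence the orders all of whose tails lie in
-- a family F form a peak-pit domain as soon as, for every triple, some singleton
-- or some complement of a singleton is not the trace on the triple of a member
-- of F.  These orders are the maximal chains of F, so F is a compact certificate:
-- 63 subsets of the 11 alternatives suffice.

module Submission where

open import Defs
open import Data.Bool.Base using (true; false; not)
open import Data.Bool.Properties using () renaming (_≟_ to _≟ᵇ_)
open import Data.Fin.Base using (Fin; zero; suc; toℕ; punchIn; punchOut)
open import Data.Fin.Patterns using (0F; 1F; 2F)
open import Data.Fin.Permutation
  using (_⟨$⟩ˡ_; _⟨$⟩ʳ_; _≈_; id; insert; insert-punchIn; inverseˡ; inverseʳ)
open import Data.Fin.Properties as Fin using (punchIn-injective; punchIn-punchOut)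
open import Data.Fin.Subset using (Subset; ⊤; ⁅_⁆; ∁; inside; outside)
open import Data.Fin.Subset.Properties using (x∈⁅x⁆)
open import Data.List.Base using (List; []; _∷_; concat; filter; length; map; tabulate; take)
open import Data.List.Membership.Propositional using (find; lose)
open import Data.List.Membership.Propositional.Properties using (∈-filter⁻)
open import Data.List.Relation.Unary.All as All using (All)
import Data.List.Relation.Unary.All.Properties as All
open import Data.List.Relation.Unary.AllPairs using ([]; _∷_)
import Data.List.Relation.Unary.AllPairs.Properties as AllPairs
open import Data.List.Relation.Unary.Any as Any using (Any)
import Data.List.Relation.Unary.Any.Properties as Any
import Data.List.Membership.Setoid as Membership
import Data.List.Relation.Unary.Unique.Setoid as UniqueSetoid
import Data.List.Relation.Unary.Unique.Setoid.Properties as Unique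
open import Data.Nat.Base as ℕ using (ℕ; zero; suc; _+_; _*_; _≤_; z≤n; s≤s; _≤ᵇ_)
import Data.Nat.Properties as ℕ
open import Data.Product.Base using (∃-syntax; _×_; _,_; proj₂; map₂)
open import Data.Sum.Base using (_⊎_; inj₁; inj₂; [_,_]′)
import Data.Sum.Base as Sum
open import Data.Vec.Base as Vec using (Vec; []; _∷_; count; lookup; removeAt)
import Data.Vec.Properties as Vec
open import Data.Vec.Relation.Unary.All as VecAll using ([]; _∷_)
open import Function.Base using (_∘_; case_of_)
open import Function.Construct.Identity using (⇔-id)
open import Level using (0ℓ)
open import Relation.Binary.Definitions using (tri<; tri≈; tri>)
open import Relation.Binary.PropositionalEquality
  using (_≡_; _≢_; refl; sym; trans; cong; subst; module ≡-Reasoning)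
open import Relation.Nullary using (¬_; Dec; yes; no; contradiction)
open import Relation.Nullary.Decidable using (toWitness; ¬?; _⊎-dec_; dec-true; dec-false)
open import Relation.Unary using (Pred; Decidable; _∈_)

private
  variable
    m n : ℕ

-- Counting entries of a vector

count≡length⇒all : ∀ {A : Set} {P : Pred A 0ℓ} (P? : Decidable P) (v : Vec A n) →
                   count P? v ≡ n → ∀ i → P (lookup v i)
count≡length⇒all {n = suc n} P? (x ∷ v) eq i with P? x
... | no _ = contradiction (Vec.count≤n P? v) (ℕ.<⇒≱ (ℕ.≤-reflexive (sym eq)))
count≡length⇒all P? (x ∷ v) eq zero    | yes p = p
count≡length⇒all P? (x ∷ v) eq (suc i) | yes _ = count≡length⇒all P? v (ℕ.suc-injective eq) i

-- The count leaves room for exactly one failure, and the entry at `i` already uses it up.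
count≡length-1⇒others : ∀ {A : Set} {P : Pred A 0ℓ} (P? : Decidable P) (v : Vec A (suc n)) →
                        count P? v ≡ n → ∀ i → ¬ P (lookup v i) → ∀ j → j ≢ i → P (lookup v j)
count≡length-1⇒others P? (x ∷ v) eq i ¬p j j≢i with P? x
count≡length-1⇒others P? (x ∷ v) eq zero ¬p j j≢i | yes p = contradiction p ¬p
count≡length-1⇒others P? (x ∷ v) eq (suc i) ¬p zero j≢i | yes p = p
count≡length-1⇒others P? (x ∷ v@(_ ∷ _)) eq (suc i) ¬p (suc j) j≢i | yes p =
  count≡length-1⇒others P? v (ℕ.suc-injective eq) i ¬p j (j≢i ∘ cong suc)
count≡length-1⇒others P? (x ∷ v) eq zero    ¬p zero j≢i | no _ = contradiction refl j≢i
count≡length-1⇒others P? (x ∷ v) eq (suc i) ¬p zero j≢i | no _ =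
  contradiction (count≡length⇒all P? v eq i) ¬p
count≡length-1⇒others P? (x ∷ v) eq i ¬p (suc j) j≢i | no ¬q = count≡length⇒all P? v eq j

count≡0⇒none : ∀ {A : Set} {P : Pred A 0ℓ} (P? : Decidable P) (v : Vec A n) →
               count P? v ≡ 0 → ∀ i → ¬ P (lookup v i)
count≡0⇒none P? (x ∷ v) eq i with P? x
count≡0⇒none P? (x ∷ v) eq zero    | no ¬p = ¬p
count≡0⇒none P? (x ∷ v) eq (suc i) | no _  = count≡0⇒none P? v eq i

module _ {A : Set} {P Q : Pred A 0ℓ} (P? : Decidable P) (Q? : Decidable Q) where

  count-mono : {v : Vec A n} → VecAll.All (λ x → P x → Q x) v → count P? v ≤ count Q? v
  count-mono [] = z≤n
  count-mono {v = x ∷ v} (h ∷ hs) with P? x | Q? x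
  ... | yes p | yes _ = s≤s (count-mono hs)
  ... | yes p | no ¬q = contradiction (h p) ¬q
  ... | no _  | yes _ = ℕ.m≤n⇒m≤1+n (count-mono hs)
  ... | no _  | no _  = count-mono hs

  count-complement : (∀ x → P x → ¬ Q x) → (∀ x → ¬ P x → Q x) →
                     (v : Vec A n) → count P? v + count Q? v ≡ n
  count-complement p⇒¬q ¬p⇒q [] = refl
  count-complement p⇒¬q ¬p⇒q (x ∷ v) with P? x | Q? x
  ... | yes p | yes q = contradiction q (p⇒¬q x p)
  ... | yes _ | no _  = cong suc (count-complement p⇒¬q ¬p⇒q v)
  ... | no _  | yes _ = trans (ℕ.+-suc _ _) (cong suc (count-complement p⇒¬q ¬p⇒q v))
  ... | no ¬p | no ¬q = contradiction (¬p⇒q x ¬p) ¬q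

-- Preferences and majority relations

prefers-total : (π : LinearOrder n) → ∀ {x y} → x ≢ y → ¬ Prefers π x y → Prefers π y x
prefers-total π {x} {y} x≢y ¬xy with Fin.<-cmp (π ⟨$⟩ˡ x) (π ⟨$⟩ˡ y)
... | tri< xy _ _ = contradiction xy ¬xy
... | tri> _ _ yx = yx
... | tri≈ _ eq _ = contradiction (trans (sym (inverseʳ π)) (trans (cong (π ⟨$⟩ʳ_) eq) (inverseʳ π))) x≢y

support-mono : ∀ {x y z w} (P : Profile n m) →
               VecAll.All (λ π → Prefers π x y → Prefers π z w) P →
               support P x y ≤ support P z w
support-mono {x = x} {y} {z} {w} P =
  count-mono (λ π → prefers? π x y) (λ π → prefers? π z w)

support-total : ∀ {x y} (P : Profile n m) → x ≢ y → support P x y + support P y x ≡ m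
support-total {x = x} {y} P x≢y =
  count-complement (λ π → prefers? π x y) (λ π → prefers? π y x)
    (λ π → Fin.<-asym) (λ π → prefers-total π x≢y) P

-- By contraposition, whoever prefers `w` to `z` prefers `y` to `x`. So in passing from the pair
-- `x`, `y` to the pair `z`, `w` the support does not fall and the opposition does not rise.
majority-mono : ∀ {x y z w} (P : Profile n m) → x ≢ y →
                VecAll.All (λ π → Prefers π x y → Prefers π z w) P →
                Majority P x y → Majority P z w
majority-mono {x = x} {y} {z} {w} P x≢y hs yx<xy = ℕ.≤-<-trans
  (support-mono P (VecAll.map (λ {π} h wz → prefers-total π x≢y (Fin.<-asym wz ∘ h)) hs))
  (ℕ.<-≤-trans yx<xy (support-mono P hs))

majority⇒≢ : ∀ {x y} (P : Profile n m) → Majority P x y → x ≢ y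
majority⇒≢ P xy refl = ℕ.<-irrefl refl xy

-- A tie would split an odd number of agents into two equal halves.
majority-total : ∀ k {x y} (P : Profile n (suc (2 * k))) → x ≢ y →
                 ¬ Majority P y x → Majority P x y
majority-total k {x} {y} P x≢y ¬yx with ℕ.<-cmp (support P x y) (support P y x)
... | tri< yx _ _ = contradiction yx ¬yx
... | tri> _ _ xy = xy
... | tri≈ _ eq _ = contradiction 2*s≡m (ℕ.even≢odd (support P x y) k)
  where
  2*s≡m : 2 * support P x y ≡ suc (2 * k)
  2*s≡m = begin
    support P x y + (support P x y + 0) ≡⟨ cong (support P x y +_) (trans (ℕ.+-identityʳ _) eq) ⟩
    support P x y + support P y x       ≡⟨ support-total P x≢y ⟩
    suc (2 * k)                         ∎
    where open ≡-Reasoning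

-- Peak-pit domains

NeverLast : Domain n → Vec (Fin n) m → Fin m → Set
NeverLast D t i = ∀ π → π ∈ D → ¬ (∀ j → j ≢ i → Prefers π (lookup t j) (lookup t i))

NeverFirst : Domain n → Vec (Fin n) m → Fin m → Set
NeverFirst D t i = ∀ π → π ∈ D → ¬ (∀ j → j ≢ i → Prefers π (lookup t i) (lookup t j))

neverLast⇒N3 : (D : Domain n) (t : Vec (Fin n) 3) → ∀ i → NeverLast D t i → Never D t i 3
neverLast⇒N3 D t i never π π∈D eq = never π π∈D
  (count≡length-1⇒others _ t (ℕ.suc-injective eq) i (ℕ.<-irrefl refl))

-- The cyclic successor. A majority cycle looks the same from each of its three alternatives, so the
-- cycle argument can start at any `i` without a case distinction.
next : Fin 3 → Fin 3
next 0F = 1F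
next 1F = 2F
next 2F = 0F

next³ : ∀ i → next (next (next i)) ≡ i
next³ 0F = refl
next³ 1F = refl
next³ 2F = refl

others : {Q : Pred (Fin 3) 0ℓ} → ∀ i → Q (next i) → Q (next (next i)) → ∀ j → j ≢ i → Q j
others 0F p q 0F j≢i = contradiction refl j≢i
others 0F p q 1F j≢i = p
others 0F p q 2F j≢i = q
others 1F p q 0F j≢i = q
others 1F p q 1F j≢i = contradiction refl j≢i
others 1F p q 2F j≢i = p
others 2F p q 0F j≢i = p
others 2F p q 1F j≢i = q
others 2F p q 2F j≢i = contradiction refl j≢i

-- A count of zero says only that no entry is preferred to the one at `i`. Distinctness turns this
-- into a strict preference for that entry over the others.
neverFirst⇒N1 : (D : Domain n) (t : Vec (Fin n) 3) → (∀ j → lookup t j ≢ lookup t (next j)) →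
                ∀ i → NeverFirst D t i → Never D t i 1
neverFirst⇒N1 D t distinct i never π π∈D eq = never π π∈D λ j j≢i →
  prefers-total π (others {λ j → lookup t j ≢ lookup t i} i (distinct i ∘ sym) distinct′ j j≢i)
    (count≡0⇒none _ t (ℕ.suc-injective eq) j)
  where
  distinct′ : lookup t (next (next i)) ≢ lookup t i
  distinct′ eq = distinct (next (next i)) (trans eq (cong (lookup t) (sym (next³ i))))

-- In a majority cycle a → b → c → a, if a is never last, then whoever prefers c
-- to a also prefers c to b; if a is never first, then whoever prefers a to b
-- also prefers c to b.  Either way c beats b.
acyclic : (D : Domain n) (P : Profile n m) → VecAll.All (_∈ D) P →
          (t : Vec (Fin n) 3) → ∀ i → NeverLast D t i ⊎ NeverFirst D t i →
          ¬ (∀ j → Majority P (lookup t j) (lookup t (next j)))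
acyclic {n = n} D P P⊆D t i never cycle = ℕ.<-asym bc cb
  where
  a b c : Fin n
  a = lookup t i
  b = lookup t (next i)
  c = lookup t (next (next i))

  ab : Majority P a b
  ab = cycle i

  bc : Majority P b c
  bc = cycle (next i)

  ca : Majority P c a
  ca = subst (λ j → Majority P c (lookup t j)) (next³ i) (cycle (next (next i)))

  c≢b : c ≢ b
  c≢b = majority⇒≢ P bc ∘ sym

  ca⇒cb : NeverLast D t i → ∀ {π} → π ∈ D → Prefers π c a → Prefers π c b
  ca⇒cb h {π} π∈D c<a = prefers-total π (c≢b ∘ sym) λ b<c →
    h π π∈D (others i (Fin.<-trans b<c c<a) c<a)

  ab⇒cb : NeverFirst D t i → ∀ {π} → π ∈ D → Prefers π a b → Prefers π c b
  ab⇒cb h {π} π∈D a<b = prefers-total π (c≢b ∘ sym) λ b<c →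
    h π π∈D (others i a<b (Fin.<-trans a<b b<c))

  cb : Majority P c b
  cb = case never of λ where
    (inj₁ h) → majority-mono P (majority⇒≢ P ca) (VecAll.map (ca⇒cb h) P⊆D) ca
    (inj₂ h) → majority-mono P (majority⇒≢ P ab) (VecAll.map (ab⇒cb h) P⊆D) ab

-- Stated for arbitrary vectors, since the triples tested for transitivity come in any order.
PeakPitOn : Domain n → Vec (Fin n) 3 → Set
PeakPitOn D t = (∃[ i ] NeverLast D t i) ⊎ (∃[ i ] NeverFirst D t i)

isPeakPit : (D : Domain n) → (∀ t → PeakPitOn D t) → IsPeakPit D
isPeakPit D pp x y z x<y y<z = Sum.map
  (map₂ (λ {i} → neverLast⇒N3 D t i))
  (map₂ (λ {i} → neverFirst⇒N1 D t distinct i))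
  (pp t)
  where
  t = x ∷ y ∷ z ∷ []

  distinct : ∀ j → lookup t j ≢ lookup t (next j)
  distinct 0F = Fin.<⇒≢ x<y
  distinct 1F = Fin.<⇒≢ y<z
  distinct 2F = Fin.<⇒≢ (Fin.<-trans x<y y<z) ∘ sym

-- With an odd number of agents, a failure of transitivity closes the majority cycle x → y → z → x.
isCondorcet : (D : Domain n) → (∀ t → PeakPitOn D t) → IsCondorcet D
isCondorcet D pp k P P⊆D {x} {y} {z} xy yz = majority-total k P x≢z λ zx →
  let i , never = [ map₂ inj₁ , map₂ inj₂ ]′ (pp (x ∷ y ∷ z ∷ []))
  in acyclic D P P⊆D (x ∷ y ∷ z ∷ []) i never λ where
    0F → xy
    1F → yz
    2F → zx
  where
  x≢z : x ≢ z
  x≢z refl = ℕ.<-asym xy yz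

-- Maximal chains of a family of sets

Family : ℕ → Set
Family n = List (Subset n)

-- The tails that can remain once `i` is ranked first, on the renumbered alternatives. In terms of
-- complements, the sets already ranked, this is the usual link of the vertex `i`.
link : Fin (suc n) → Family (suc n) → Family n
link i F = map (λ U → removeAt U i) (filter (λ U → lookup U i ≟ᵇ outside) F)

-- After passing to links the remaining alternatives always form the full set, so this one test
-- decides whether the current tail lies in the original family.
full? : (F : Family n) → Dec (Any (⊤ ≡_) F)
full? = Any.any? (Vec.≡-dec _≟ᵇ_ ⊤)

-- A maximal chain of F, from the full set down to the empty set, is read as the
-- order in which the alternatives are removed.
chains     : ∀ n → Family n → List (LinearOrder n)
extensions : ∀ n → Family n → List (LinearOrder n)

chains n F with full? F
... | yes _ = extensions n F
... | no  _ = []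

extensions zero    F = id ∷ []
extensions (suc n) F = concat (tabulate λ i → map (insert zero i) (chains n (link i F)))

-- Orders from different blocks of the concatenation differ in their most preferred alternative, and
-- within a block `insert zero i` is injective.
unique-chains     : ∀ n F → UniqueSetoid.Unique (linearOrders n) (chains n F)
unique-extensions : ∀ n F → UniqueSetoid.Unique (linearOrders n) (extensions n F)

unique-chains n F with full? F
... | yes _ = unique-extensions n F
... | no  _ = []

unique-extensions zero    F = All.[] ∷ []
unique-extensions (suc n) F = Unique.concat⁺ (linearOrders (suc n))
  (All.tabulate⁺ λ i → Unique.map⁺ (linearOrders n) (linearOrders (suc n)) {insert zero i}
    (λ {π} {ρ} → insert-injective i π ρ) (unique-chains n (link i F)))
  (AllPairs.tabulate⁺ {f = λ i → map (insert zero i) (chains n (link i F))}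
    λ {i} {j} i≢j {π} (∈i , ∈j) → i≢j (trans (sym (first i π _ ∈i)) (first j π _ ∈j)))
  where
  open Membership (linearOrders (suc n)) using () renaming (_∈_ to _∈ₗ_)

  insert-injective : ∀ i (π ρ : LinearOrder n) → insert zero i π ≈ insert zero i ρ → π ≈ ρ
  insert-injective i π ρ eq k = punchIn-injective i _ _
    (trans (sym (insert-punchIn zero i π k)) (trans (eq (suc k)) (insert-punchIn zero i ρ k)))

  first : ∀ i π πs → π ∈ₗ map (insert zero i) πs → π ⟨$⟩ʳ zero ≡ i
  first i π πs π∈ = proj₂ (Any.satisfied (Any.map⁻ π∈)) zero

unique-take-chains : ∀ k n F → UniqueSetoid.Unique (linearOrders n) (take k (chains n F))
unique-take-chains k n F = Unique.take⁺ (linearOrders n) k (unique-chains n F)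

-- The alternatives that π ranks at position p or later form a member of F.
Tail : Family n → LinearOrder n → ℕ → Set
Tail F π p = Any (λ U → ∀ x → lookup U x ≡ (p ≤ᵇ toℕ (π ⟨$⟩ˡ x))) F

-- Putting `i` in front shifts every other alternative down by one position, so the tail from
-- `suc p` excludes `i` and is the old tail from `p` elsewhere.
tail-extend : ∀ (F : Family (suc n)) i π p → Tail (link i F) π p → Tail F (insert zero i π) (suc p)
tail-extend F i π p tail with find (Any.map⁻ tail)
... | U , U∈filter , h with ∈-filter⁻ (λ U → lookup U i ≟ᵇ outside) U∈filter
...   | U∈F , i∉U = lose U∈F pointwise
  where
  open ≡-Reasoning

  -- `suc p ≤ᵇ suc q` reduces to `p <ᵇ suc q`, which agrees with `p ≤ᵇ q` only after a case split on
  -- `p`.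
  <ᵇ-suc : ∀ p q → (p ≤ᵇ q) ≡ (suc p ≤ᵇ suc q)
  <ᵇ-suc zero    q = refl
  <ᵇ-suc (suc p) q = refl

  position-punchIn : ∀ x → insert zero i π ⟨$⟩ˡ punchIn i x ≡ suc (π ⟨$⟩ˡ x)
  position-punchIn x = begin
    ρ ⟨$⟩ˡ punchIn i x                     ≡⟨ cong (λ y → ρ ⟨$⟩ˡ punchIn i y) (inverseʳ π) ⟨
    ρ ⟨$⟩ˡ punchIn i (π ⟨$⟩ʳ (π ⟨$⟩ˡ x))   ≡⟨ cong (ρ ⟨$⟩ˡ_) (insert-punchIn zero i π (π ⟨$⟩ˡ x)) ⟨
    ρ ⟨$⟩ˡ (ρ ⟨$⟩ʳ suc (π ⟨$⟩ˡ x))         ≡⟨ inverseˡ ρ ⟩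
    suc (π ⟨$⟩ˡ x)                         ∎
    where ρ = insert zero i π

  position-first : insert zero i π ⟨$⟩ˡ i ≡ zero
  position-first = inverseˡ (insert zero i π) {zero}

  pointwise : ∀ x → lookup U x ≡ (suc p ≤ᵇ toℕ (insert zero i π ⟨$⟩ˡ x))
  pointwise x = case i Fin.≟ x of λ where
    (yes refl) → trans i∉U (cong (λ y → suc p ≤ᵇ toℕ y) (sym position-first))
    (no i≢x) → begin
      lookup U x                                   ≡⟨ Vec.removeAt-punchOut U i≢x ⟨
      lookup (removeAt U i) (punchOut i≢x)         ≡⟨ h (punchOut i≢x) ⟩
      (p ≤ᵇ toℕ (π ⟨$⟩ˡ punchOut i≢x))             ≡⟨ <ᵇ-suc p _ ⟩
      (suc p ≤ᵇ suc (toℕ (π ⟨$⟩ˡ punchOut i≢x)))   ≡⟨ cong (λ y → suc p ≤ᵇ toℕ y) (position-punchIn (punchOut i≢x)) ⟨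
      (suc p ≤ᵇ toℕ (insert zero i π ⟨$⟩ˡ punchIn i (punchOut i≢x)))
        ≡⟨ cong (λ y → suc p ≤ᵇ toℕ (insert zero i π ⟨$⟩ˡ y)) (punchIn-punchOut i≢x) ⟩
      (suc p ≤ᵇ toℕ (insert zero i π ⟨$⟩ˡ x))      ∎

tail-chains     : ∀ n F → All (λ π → ∀ p → Tail F π p) (chains n F)
tail-extensions : ∀ n F → Any (⊤ ≡_) F → All (λ π → ∀ p → Tail F π p) (extensions n F)

tail-chains n F with full? F
... | yes full = tail-extensions n F full
... | no  _    = All.[]

-- Without alternatives the pointwise condition is vacuous, so the member found by `full` serves for
-- every `p`, including positions past the end.
tail-extensions zero    F full = (λ p → Any.map (λ { refl () }) full) All.∷ All.[]
tail-extensions (suc n) F full = All.concat⁺ (All.tabulate⁺ λ i →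
  All.map⁺ {f = insert zero i} (All.map (λ {π} → extend i π) (tail-chains n (link i F))))
  where
  extend : ∀ i π → (∀ p → Tail (link i F) π p) → ∀ p → Tail F (insert zero i π) p
  extend i π tail zero    = Any.map (λ { refl x → Vec.lookup-replicate x inside }) full
  extend i π tail (suc p) = tail-extend F i π p (tail p)

-- `_≈_` compares the maps from positions to alternatives, whereas tails refer to the inverse maps.
≈⇒position : (π ρ : LinearOrder n) → π ≈ ρ → ∀ x → π ⟨$⟩ˡ x ≡ ρ ⟨$⟩ˡ x
≈⇒position π ρ π≈ρ x = begin
  π ⟨$⟩ˡ x                    ≡⟨ cong (π ⟨$⟩ˡ_) (inverseʳ ρ) ⟨
  π ⟨$⟩ˡ (ρ ⟨$⟩ʳ (ρ ⟨$⟩ˡ x))  ≡⟨ cong (π ⟨$⟩ˡ_) (π≈ρ (ρ ⟨$⟩ˡ x)) ⟨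
  π ⟨$⟩ˡ (π ⟨$⟩ʳ (ρ ⟨$⟩ˡ x))  ≡⟨ inverseˡ π ⟩
  ρ ⟨$⟩ˡ x                    ∎
  where open ≡-Reasoning

tail-≈ : ∀ (F : Family n) π ρ p → π ≈ ρ → Tail F ρ p → Tail F π p
tail-≈ F π ρ p π≈ρ = Any.map λ h x →
  trans (h x) (cong (λ y → p ≤ᵇ toℕ y) (sym (≈⇒position π ρ π≈ρ x)))

-- Traces of a family

trace : Subset n → Vec (Fin n) m → Subset m
trace U t = Vec.map (lookup U) t

Omits : Family n → Vec (Fin n) m → Set
Omits F t =
  (∃[ i ] All (λ U → trace U t ≢ ⁅ i ⁆) F) ⊎ (∃[ i ] All (λ U → trace U t ≢ ∁ ⁅ i ⁆) F)

omits? : (F : Family n) (t : Vec (Fin n) m) → Dec (Omits F t)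
omits? F t =
  Fin.any? (λ i → All.all? (λ U → ¬? (Vec.≡-dec _≟ᵇ_ (trace U t) ⁅ i ⁆)) F) ⊎-dec
  Fin.any? (λ i → All.all? (λ U → ¬? (Vec.≡-dec _≟ᵇ_ (trace U t) (∁ ⁅ i ⁆))) F)

lookup-⁅⁆-≡ : ∀ (i : Fin n) → lookup ⁅ i ⁆ i ≡ inside
lookup-⁅⁆-≡ i = Vec.[]=⇒lookup (x∈⁅x⁆ i)

lookup-⁅⁆-≢ : ∀ {i j : Fin n} → j ≢ i → lookup ⁅ i ⁆ j ≡ outside
lookup-⁅⁆-≢ {i = zero}  {zero}  j≢i = contradiction refl j≢i
lookup-⁅⁆-≢ {i = zero}  {suc j} j≢i = Vec.lookup-replicate j outside
lookup-⁅⁆-≢ {i = suc i} {zero}  j≢i = refl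
lookup-⁅⁆-≢ {i = suc i} {suc j} j≢i = lookup-⁅⁆-≢ (j≢i ∘ cong suc)

lookup-extensional : ∀ {A : Set} {u v : Vec A n} → (∀ i → lookup u i ≡ lookup v i) → u ≡ v
lookup-extensional {u = u} {v} eq =
  trans (sym (Vec.tabulate∘lookup u)) (trans (Vec.tabulate-cong eq) (Vec.tabulate∘lookup v))

≤⇒≤ᵇ≡true : ∀ {p q} → p ≤ q → (p ≤ᵇ q) ≡ true
≤⇒≤ᵇ≡true {p} {q} p≤q = dec-true (p ℕ.≤? q) p≤q

>⇒≤ᵇ≡false : ∀ {p q} → q ℕ.< p → (p ≤ᵇ q) ≡ false
>⇒≤ᵇ≡false {p} {q} q<p = dec-false (p ℕ.≤? q) (ℕ.<⇒≱ q<p)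

module _ (D : Domain n) (F : Family n) (tails : ∀ π → π ∈ D → ∀ p → Tail F π p)
         (t : Vec (Fin n) m) (i : Fin m) where

  private
    pos : LinearOrder n → Fin m → ℕ
    pos π j = toℕ (π ⟨$⟩ˡ lookup t j)

  omits⇒neverLast : All (λ U → trace U t ≢ ⁅ i ⁆) F → NeverLast D t i
  -- If the entry at `i` came last, the tail starting at its own position would contain it and no
  -- other entry.
  omits⇒neverLast omits π π∈D last with All.lookupAny omits (tails π π∈D (pos π i))
  ... | trace≢ , tail = trace≢ (lookup-extensional λ j →
    trans (Vec.lookup-map j _ t) (trans (tail (lookup t j)) (pointwise j)))
    where
    pointwise : ∀ j → (pos π i ≤ᵇ pos π j) ≡ lookup ⁅ i ⁆ j
    pointwise j with j Fin.≟ i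
    ... | yes refl = trans (≤⇒≤ᵇ≡true (ℕ.≤-refl {pos π i})) (sym (lookup-⁅⁆-≡ i))
    ... | no  j≢i  = trans (>⇒≤ᵇ≡false (last j j≢i)) (sym (lookup-⁅⁆-≢ j≢i))

  omits⇒neverFirst : All (λ U → trace U t ≢ ∁ ⁅ i ⁆) F → NeverFirst D t i
  -- Here the tail starts one position later: it loses the entry at `i` and keeps all those ranked
  -- below it.
  omits⇒neverFirst omits π π∈D first with All.lookupAny omits (tails π π∈D (suc (pos π i)))
  ... | trace≢ , tail = trace≢ (lookup-extensional λ j →
    trans (Vec.lookup-map j _ t) (trans (tail (lookup t j))
      (trans (pointwise j) (sym (Vec.lookup-map j not ⁅ i ⁆)))))
    where
    pointwise : ∀ j → (suc (pos π i) ≤ᵇ pos π j) ≡ not (lookup ⁅ i ⁆ j)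
    pointwise j with j Fin.≟ i
    ... | yes refl = trans (>⇒≤ᵇ≡false (ℕ.n<1+n (pos π i))) (cong not (sym (lookup-⁅⁆-≡ i)))
    ... | no  j≢i  = trans (≤⇒≤ᵇ≡true (first j j≢i)) (cong not (sym (lookup-⁅⁆-≢ j≢i)))

omits⇒peakPitOn : (D : Domain n) (F : Family n) → (∀ π → π ∈ D → ∀ p → Tail F π p) →
                  ∀ t → Omits F t → PeakPitOn D t
omits⇒peakPitOn D F tails t = Sum.map
  (map₂ (λ {i} → omits⇒neverLast D F tails t i))
  (map₂ (λ {i} → omits⇒neverFirst D F tails t i))

-- The certifying family and its domain

pattern ● = inside
pattern ○ = outside

-- Found by simulated annealing over assignments of peak-pit never conditions to
-- the 165 triples.  The family has 2350 maximal chains, so one is dropped below.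
tailFamily : Family 11
tailFamily =
    (● ∷ ● ∷ ● ∷ ● ∷ ● ∷ ● ∷ ● ∷ ● ∷ ● ∷ ● ∷ ● ∷ [])
  ∷ (● ∷ ● ∷ ● ∷ ● ∷ ○ ∷ ● ∷ ● ∷ ● ∷ ● ∷ ● ∷ ● ∷ [])
  ∷ (● ∷ ● ∷ ○ ∷ ● ∷ ● ∷ ● ∷ ● ∷ ● ∷ ● ∷ ● ∷ ● ∷ [])
  ∷ (● ∷ ○ ∷ ● ∷ ● ∷ ● ∷ ● ∷ ● ∷ ● ∷ ● ∷ ● ∷ ● ∷ [])
  ∷ (○ ∷ ● ∷ ● ∷ ● ∷ ● ∷ ● ∷ ● ∷ ● ∷ ● ∷ ● ∷ ● ∷ [])
  ∷ (● ∷ ○ ∷ ● ∷ ● ∷ ○ ∷ ● ∷ ● ∷ ● ∷ ● ∷ ● ∷ ● ∷ [])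
  ∷ (○ ∷ ● ∷ ○ ∷ ● ∷ ● ∷ ● ∷ ● ∷ ● ∷ ● ∷ ● ∷ ● ∷ [])
  ∷ (○ ∷ ○ ∷ ● ∷ ● ∷ ● ∷ ● ∷ ● ∷ ● ∷ ● ∷ ● ∷ ● ∷ [])
  ∷ (● ∷ ○ ∷ ● ∷ ● ∷ ○ ∷ ○ ∷ ● ∷ ● ∷ ● ∷ ● ∷ ● ∷ [])
  ∷ (○ ∷ ● ∷ ○ ∷ ● ∷ ● ∷ ○ ∷ ● ∷ ● ∷ ● ∷ ● ∷ ● ∷ [])
  ∷ (● ∷ ○ ∷ ● ∷ ○ ∷ ○ ∷ ● ∷ ● ∷ ● ∷ ● ∷ ● ∷ ● ∷ [])
  ∷ (○ ∷ ○ ∷ ● ∷ ● ∷ ○ ∷ ● ∷ ● ∷ ● ∷ ● ∷ ● ∷ ● ∷ [])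
  ∷ (○ ∷ ● ∷ ○ ∷ ○ ∷ ● ∷ ● ∷ ● ∷ ● ∷ ● ∷ ● ∷ ● ∷ [])
  ∷ (○ ∷ ○ ∷ ○ ∷ ● ∷ ● ∷ ● ∷ ● ∷ ● ∷ ● ∷ ● ∷ ● ∷ [])
  ∷ (● ∷ ○ ∷ ● ∷ ● ∷ ○ ∷ ○ ∷ ● ∷ ● ∷ ○ ∷ ● ∷ ● ∷ [])
  ∷ (○ ∷ ● ∷ ○ ∷ ● ∷ ● ∷ ○ ∷ ● ∷ ● ∷ ○ ∷ ● ∷ ● ∷ [])
  ∷ (● ∷ ○ ∷ ● ∷ ○ ∷ ○ ∷ ● ∷ ○ ∷ ● ∷ ● ∷ ● ∷ ● ∷ [])
  ∷ (○ ∷ ● ∷ ○ ∷ ○ ∷ ● ∷ ● ∷ ○ ∷ ● ∷ ● ∷ ● ∷ ● ∷ [])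
  ∷ (○ ∷ ○ ∷ ● ∷ ● ∷ ○ ∷ ○ ∷ ● ∷ ● ∷ ● ∷ ● ∷ ● ∷ [])
  ∷ (○ ∷ ○ ∷ ○ ∷ ● ∷ ● ∷ ○ ∷ ● ∷ ● ∷ ● ∷ ● ∷ ● ∷ [])
  ∷ (○ ∷ ○ ∷ ● ∷ ○ ∷ ○ ∷ ● ∷ ● ∷ ● ∷ ● ∷ ● ∷ ● ∷ [])
  ∷ (○ ∷ ○ ∷ ○ ∷ ● ∷ ○ ∷ ● ∷ ● ∷ ● ∷ ● ∷ ● ∷ ● ∷ [])
  ∷ (○ ∷ ○ ∷ ○ ∷ ○ ∷ ● ∷ ● ∷ ● ∷ ● ∷ ● ∷ ● ∷ ● ∷ [])
  ∷ (● ∷ ○ ∷ ● ∷ ● ∷ ○ ∷ ○ ∷ ● ∷ ● ∷ ○ ∷ ○ ∷ ● ∷ [])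
  ∷ (○ ∷ ○ ∷ ● ∷ ● ∷ ○ ∷ ○ ∷ ● ∷ ● ∷ ○ ∷ ● ∷ ● ∷ [])
  ∷ (○ ∷ ○ ∷ ○ ∷ ● ∷ ● ∷ ○ ∷ ● ∷ ● ∷ ○ ∷ ● ∷ ● ∷ [])
  ∷ (○ ∷ ○ ∷ ● ∷ ○ ∷ ○ ∷ ● ∷ ○ ∷ ● ∷ ● ∷ ● ∷ ● ∷ [])
  ∷ (○ ∷ ○ ∷ ○ ∷ ○ ∷ ● ∷ ● ∷ ○ ∷ ● ∷ ● ∷ ● ∷ ● ∷ [])
  ∷ (○ ∷ ○ ∷ ○ ∷ ● ∷ ○ ∷ ○ ∷ ● ∷ ● ∷ ● ∷ ● ∷ ● ∷ [])
  ∷ (○ ∷ ○ ∷ ○ ∷ ○ ∷ ○ ∷ ● ∷ ● ∷ ● ∷ ● ∷ ● ∷ ● ∷ [])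
  ∷ (● ∷ ○ ∷ ● ∷ ● ∷ ○ ∷ ○ ∷ ● ∷ ● ∷ ○ ∷ ○ ∷ ○ ∷ [])
  ∷ (○ ∷ ○ ∷ ● ∷ ● ∷ ○ ∷ ○ ∷ ● ∷ ● ∷ ○ ∷ ○ ∷ ● ∷ [])
  ∷ (○ ∷ ○ ∷ ○ ∷ ● ∷ ● ∷ ○ ∷ ● ∷ ● ∷ ○ ∷ ○ ∷ ● ∷ [])
  ∷ (○ ∷ ○ ∷ ○ ∷ ● ∷ ○ ∷ ○ ∷ ● ∷ ● ∷ ○ ∷ ● ∷ ● ∷ [])
  ∷ (○ ∷ ○ ∷ ○ ∷ ○ ∷ ○ ∷ ● ∷ ● ∷ ● ∷ ○ ∷ ● ∷ ● ∷ [])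
  ∷ (○ ∷ ○ ∷ ● ∷ ○ ∷ ○ ∷ ● ∷ ○ ∷ ○ ∷ ● ∷ ● ∷ ● ∷ [])
  ∷ (○ ∷ ○ ∷ ○ ∷ ○ ∷ ● ∷ ● ∷ ○ ∷ ○ ∷ ● ∷ ● ∷ ● ∷ [])
  ∷ (○ ∷ ○ ∷ ○ ∷ ○ ∷ ○ ∷ ● ∷ ○ ∷ ● ∷ ● ∷ ● ∷ ● ∷ [])
  ∷ (○ ∷ ○ ∷ ○ ∷ ○ ∷ ○ ∷ ○ ∷ ● ∷ ● ∷ ● ∷ ● ∷ ● ∷ [])
  ∷ (○ ∷ ○ ∷ ● ∷ ● ∷ ○ ∷ ○ ∷ ● ∷ ● ∷ ○ ∷ ○ ∷ ○ ∷ [])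
  ∷ (○ ∷ ○ ∷ ○ ∷ ● ∷ ● ∷ ○ ∷ ● ∷ ● ∷ ○ ∷ ○ ∷ ○ ∷ [])
  ∷ (○ ∷ ○ ∷ ○ ∷ ● ∷ ○ ∷ ○ ∷ ● ∷ ● ∷ ○ ∷ ○ ∷ ● ∷ [])
  ∷ (○ ∷ ○ ∷ ○ ∷ ○ ∷ ○ ∷ ● ∷ ● ∷ ● ∷ ○ ∷ ○ ∷ ● ∷ [])
  ∷ (○ ∷ ○ ∷ ○ ∷ ● ∷ ○ ∷ ○ ∷ ○ ∷ ● ∷ ○ ∷ ● ∷ ● ∷ [])
  ∷ (○ ∷ ○ ∷ ○ ∷ ○ ∷ ○ ∷ ○ ∷ ● ∷ ● ∷ ○ ∷ ● ∷ ● ∷ [])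
  ∷ (○ ∷ ○ ∷ ○ ∷ ○ ∷ ○ ∷ ● ∷ ○ ∷ ○ ∷ ● ∷ ● ∷ ● ∷ [])
  ∷ (○ ∷ ○ ∷ ○ ∷ ○ ∷ ○ ∷ ○ ∷ ○ ∷ ● ∷ ● ∷ ● ∷ ● ∷ [])
  ∷ (○ ∷ ○ ∷ ○ ∷ ● ∷ ○ ∷ ○ ∷ ● ∷ ● ∷ ○ ∷ ○ ∷ ○ ∷ [])
  ∷ (○ ∷ ○ ∷ ○ ∷ ○ ∷ ○ ∷ ● ∷ ○ ∷ ○ ∷ ● ∷ ● ∷ ○ ∷ [])
  ∷ (○ ∷ ○ ∷ ○ ∷ ○ ∷ ○ ∷ ○ ∷ ● ∷ ● ∷ ○ ∷ ○ ∷ ● ∷ [])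
  ∷ (○ ∷ ○ ∷ ○ ∷ ○ ∷ ○ ∷ ○ ∷ ○ ∷ ● ∷ ○ ∷ ● ∷ ● ∷ [])
  ∷ (○ ∷ ○ ∷ ○ ∷ ○ ∷ ○ ∷ ○ ∷ ○ ∷ ○ ∷ ● ∷ ● ∷ ● ∷ [])
  ∷ (○ ∷ ○ ∷ ○ ∷ ● ∷ ○ ∷ ○ ∷ ● ∷ ○ ∷ ○ ∷ ○ ∷ ○ ∷ [])
  ∷ (○ ∷ ○ ∷ ○ ∷ ○ ∷ ○ ∷ ○ ∷ ● ∷ ● ∷ ○ ∷ ○ ∷ ○ ∷ [])
  ∷ (○ ∷ ○ ∷ ○ ∷ ○ ∷ ○ ∷ ○ ∷ ○ ∷ ○ ∷ ● ∷ ● ∷ ○ ∷ [])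
  ∷ (○ ∷ ○ ∷ ○ ∷ ○ ∷ ○ ∷ ○ ∷ ○ ∷ ● ∷ ○ ∷ ○ ∷ ● ∷ [])
  ∷ (○ ∷ ○ ∷ ○ ∷ ○ ∷ ○ ∷ ○ ∷ ○ ∷ ○ ∷ ○ ∷ ● ∷ ● ∷ [])
  ∷ (○ ∷ ○ ∷ ○ ∷ ○ ∷ ○ ∷ ○ ∷ ● ∷ ○ ∷ ○ ∷ ○ ∷ ○ ∷ [])
  ∷ (○ ∷ ○ ∷ ○ ∷ ○ ∷ ○ ∷ ○ ∷ ○ ∷ ● ∷ ○ ∷ ○ ∷ ○ ∷ [])
  ∷ (○ ∷ ○ ∷ ○ ∷ ○ ∷ ○ ∷ ○ ∷ ○ ∷ ○ ∷ ● ∷ ○ ∷ ○ ∷ [])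
  ∷ (○ ∷ ○ ∷ ○ ∷ ○ ∷ ○ ∷ ○ ∷ ○ ∷ ○ ∷ ○ ∷ ● ∷ ○ ∷ [])
  ∷ (○ ∷ ○ ∷ ○ ∷ ○ ∷ ○ ∷ ○ ∷ ○ ∷ ○ ∷ ○ ∷ ○ ∷ ● ∷ [])
  ∷ (○ ∷ ○ ∷ ○ ∷ ○ ∷ ○ ∷ ○ ∷ ○ ∷ ○ ∷ ○ ∷ ○ ∷ ○ ∷ [])
  ∷ []

abstract

  -- Never conditions pass to subsets of a domain, so any 2349 of the maximal chains will do.
  orders : List (LinearOrder 11)
  orders = take 2349 (chains 11 tailFamily)

  unique-orders : UniqueSetoid.Unique (linearOrders 11) orders
  unique-orders = unique-take-chains 2349 11 tailFamily

  tail-orders : All (λ π → ∀ p → Tail tailFamily π p) orders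
  tail-orders = All.take⁺ {xs = chains 11 tailFamily} 2349 (tail-chains 11 tailFamily)

  length-orders : length orders ≡ 2349
  -- Evaluates the enumeration: `take` reaches this length exactly when there are at least 2349
  -- chains.
  length-orders = refl

  -- Checked exhaustively over all triples, in any order. Triples with a repeated entry satisfy it
  -- automatically, because no trace separates equal entries.
  omits : ∀ x y z → Omits tailFamily (x ∷ y ∷ z ∷ [])
  omits = toWitness {a? = Fin.all? λ x → Fin.all? λ y → Fin.all? λ z →
                            omits? tailFamily (x ∷ y ∷ z ∷ [])} _

-- Membership is taken up to `_≈_`, so the equivalence in `HasSize` becomes the identity.
domain : Domain 11
domain π = π ∈ₗ orders
  where open Membership (linearOrders 11) using () renaming (_∈_ to _∈ₗ_)

tail-domain : ∀ π → π ∈ domain → ∀ p → Tail tailFamily π p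
tail-domain π π∈D p with All.lookupAny tail-orders π∈D
... | tail , π≈ρ = tail-≈ tailFamily π (Any.lookup π∈D) p π≈ρ (tail p)

peakPitOn-domain : ∀ t → PeakPitOn domain t
peakPitOn-domain t@(x ∷ y ∷ z ∷ []) =
  omits⇒peakPitOn domain tailFamily tail-domain t (omits x y z)

mainTheorem2 : ∃[ D ] IsCondorcet {11} D × IsPeakPit D × HasSize D 2349
mainTheorem2 =
  domain ,
  isCondorcet domain peakPitOn-domain ,
  isPeakPit domain peakPitOn-domain ,
  orders , unique-orders , length-orders , λ π → ⇔-id _
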